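{- Let $\alpha = \frac{56733}{60064} \approx 0.944542$. For every $\varepsilon > 0$ there exists a positive integer $N$ such that $\rho(n) > (\alpha - \varepsilon)\, n$ for every integer $n \geq N$.
   Context: A string is a finite sequence of symbols from a finite alphabet; $w[i]$ denotes its $i$-th symbol and $w[i:j]$ the substring from position $i$ to position $j$. A string $u$ has period $p$ if $u[i]=u[i+p]$ for $1\le i\le |u|-p$. A string $u$ is a run if its minimum period $p$ satisfies $p \leq |u|/2$. A substring $u = w[i:j]$ of $w$ is a run in $w$ if it is a run of (minimum) period $p$ and neither $w[i-1:j]$ nor $w[i:j+1]$ (whenever these exist) is a run of period $p$, i.e. the run is maximal. Runs in $w$ are counted as distinct pairs of positions $(i,j)$. $\mathrm{run}(w)$ denotes the number of runs in $w$, and $\rho(n)$ denotes the maximum of $\mathrm{run}(w)$ over all strings $w$ of length $n$ (over any finite alphabet). -}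

module Defs where

open import Data.Nat using (ℕ; zero; suc; _+_; _*_; _∸_; _≤ᵇ_; _<ᵇ_; _≡ᵇ_)
open import Data.Bool using (Bool; true; false; _∧_; _∨_; not; if_then_else_)
open import Data.Fin using (Fin)
import Data.Fin as F
open import Data.Vec using (Vec; []; _∷_)
open import Data.Maybe using (Maybe; just; nothing)
open import Data.List using (List; upTo; map; concatMap)
open import Data.Bool.ListAction using (all; any)
open import Data.Nat.ListAction using (sum)
open import Relation.Nullary.Decidable using (⌊_⌋)

-- Strings of length n over the finite alphabet Fin k are Vec (Fin k) n.
-- Positions are 0-based: the symbols of w are w[0], …, w[n-1],
-- and the substring w[i:j] (i ≤ j) is w[i] … w[j] (inclusive), of length j - i + 1.

-- symbol at a position (nothing if out of range; never used out of range)
at : ∀ {A : Set} {n} → Vec A n → ℕ → Maybe A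
at []       _       = nothing
at (x ∷ xs) zero    = just x
at (x ∷ xs) (suc t) = at xs t

sameSym : ∀ {k} → Maybe (Fin k) → Maybe (Fin k) → Bool
sameSym (just a) (just b) = ⌊ a F.≟ b ⌋
sameSym _        _        = false

hasPeriod : ∀ {k n} → Vec (Fin k) n → ℕ → ℕ → ℕ → Bool
hasPeriod w i j p =
  all (λ t → sameSym (at w t) (at w (t + p))) (map (i +_) (upTo (suc j ∸ i ∸ p)))

isMinPeriod : ∀ {k n} → Vec (Fin k) n → ℕ → ℕ → ℕ → Bool
isMinPeriod w i j p =
  (1 ≤ᵇ p) ∧ hasPeriod w i j p ∧ all (λ q → not (hasPeriod w i j q)) (map suc (upTo (p ∸ 1)))

isRunOfPeriod : ∀ {k n} → Vec (Fin k) n → ℕ → ℕ → ℕ → Bool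
isRunOfPeriod w i j p = (i ≤ᵇ j) ∧ isMinPeriod w i j p ∧ (2 * p ≤ᵇ suc j ∸ i)

-- w[i:j] is a run in w: it is a run of some (minimum) period p, and neither
-- w[i-1:j] (if i > 0) nor w[i:j+1] (if j+1 < n) is a run of period p.
-- (The minimum period p of w[i:j] lies in 1 … j-i+1.)
isRunIn : ∀ {k n} → Vec (Fin k) n → ℕ → ℕ → Bool
isRunIn {n = n} w i j =
  (i ≤ᵇ j) ∧ (j <ᵇ n) ∧
  any (λ p → isRunOfPeriod w i j p
             ∧ ((i ≡ᵇ 0) ∨ not (isRunOfPeriod w (i ∸ 1) j p))
             ∧ ((suc j ≡ᵇ n) ∨ not (isRunOfPeriod w i (suc j) p)))
      (map suc (upTo (suc j ∸ i)))

run : ∀ {k n} → Vec (Fin k) n → ℕ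
run {n = n} w =
  sum (concatMap (λ i → map (λ j → if isRunIn w i j then 1 else 0) (upTo n)) (upTo n))

{-# OPTIONS --safe #-}
module Submission where

-- The prefixes of the periodic word W^ω, for a suitable binary word W of length
-- L = 79568, have R = 75156 runs per cycle, and 75156/79568 > 56733/60064.
--
-- Runs are found by scanning, for each distance p, the mismatches
-- u[x] ≠ u[x+p]. A block of k ≥ p matches between two consecutive mismatches is
-- a run of length k + p: its minimum period q divides p by Fine–Wilf, so a
-- q-periodic extension would be p-periodic and contradict a mismatch. In the
-- chosen W, a run is assigned its p by its length alone, so that blocks found
-- for different p are different runs. One cycle is scanned by evaluation;
-- periodicity carries its count over to all cycles.

open import Defs

-- Sums over intervals of natural numbers.

module RangeSum where

  open import Data.Nat
  open import Data.Nat.Properties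
  open import Data.Nat.Solver using (module +-*-Solver)
  open import Data.List using (List; []; _∷_; map; concatMap; applyUpTo; upTo)
  open import Data.Nat.ListAction using (sum)
  open import Data.Nat.ListAction.Properties using (sum-++)
  open import Data.Sum using (inj₁; inj₂)
  open import Function using (_∘_; id)
  open import Relation.Nullary using (contradiction)
  open import Relation.Binary.PropositionalEquality

  -- A window is given by its start and its length, not by two endpoints, so that adjacent windows
  -- join by adding lengths, without truncated subtraction.
  ∑ : (ℕ → ℕ) → ℕ → ℕ → ℕ
  ∑ f x zero    = 0
  ∑ f x (suc n) = f x + ∑ f (suc x) n

  ∑-++ : ∀ f x m n → ∑ f x (m + n) ≡ ∑ f x m + ∑ f (x + m) n
  ∑-++ f x zero    n = cong (λ y → ∑ f y n) (sym (+-identityʳ x))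
  ∑-++ f x (suc m) n = begin
    f x + ∑ f (suc x) (m + n)                     ≡⟨ cong (f x +_) (∑-++ f (suc x) m n) ⟩
    f x + (∑ f (suc x) m + ∑ f (suc x + m) n)     ≡⟨ +-assoc (f x) _ _ ⟨
    ∑ f x (suc m) + ∑ f (suc x + m) n             ≡⟨ cong (λ y → ∑ f x (suc m) + ∑ f y n) (+-suc x m) ⟨
    ∑ f x (suc m) + ∑ f (x + suc m) n             ∎
    where open ≡-Reasoning

  ∑-mono : ∀ {f g : ℕ → ℕ} → (∀ i → f i ≤ g i) → ∀ x n → ∑ f x n ≤ ∑ g x n
  ∑-mono f≤g x zero    = z≤n
  ∑-mono f≤g x (suc n) = +-mono-≤ (f≤g x) (∑-mono f≤g (suc x) n)

  ∑-zero : ∀ f x n → (∀ i → x ≤ i → f i ≡ 0) → ∑ f x n ≡ 0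
  ∑-zero f x zero    f≡0 = refl
  ∑-zero f x (suc n) f≡0 = cong₂ _+_ (f≡0 x ≤-refl) (∑-zero f (suc x) n (λ i x<i → f≡0 i (<⇒≤ x<i)))

  ∑-+ : ∀ f g x n → ∑ (λ i → f i + g i) x n ≡ ∑ f x n + ∑ g x n
  ∑-+ f g x zero    = refl
  ∑-+ f g x (suc n) rewrite ∑-+ f g (suc x) n =
    solve 4 (λ a b c d → a :+ b :+ (c :+ d) := a :+ c :+ (b :+ d)) refl (f x) (g x) _ _
    where open +-*-Solver

  ∑-shift : ∀ f c x n → ∑ (λ i → f (c + i)) x n ≡ ∑ f (c + x) n
  ∑-shift f c x zero    = refl
  ∑-shift f c x (suc n) = cong (f (c + x) +_)
    (trans (∑-shift f c (suc x) n) (cong (λ y → ∑ f y n) (+-suc c x)))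

  ∑-⊆ : ∀ f x m n → x + m ≤ n → ∑ f x m ≤ ∑ f 0 n
  ∑-⊆ f x m n x+m≤n = begin
    ∑ f x m                                   ≤⟨ m≤n+m _ (∑ f 0 x) ⟩
    ∑ f 0 x + ∑ f x m                         ≡⟨ ∑-++ f 0 x m ⟨
    ∑ f 0 (x + m)                             ≤⟨ m≤m+n _ _ ⟩
    ∑ f 0 (x + m) + ∑ f (x + m) (n ∸ (x + m)) ≡⟨ ∑-++ f 0 (x + m) (n ∸ (x + m)) ⟨
    ∑ f 0 (x + m + (n ∸ (x + m)))             ≡⟨ cong (∑ f 0) (m+[n∸m]≡n x+m≤n) ⟩
    ∑ f 0 n                                   ∎
    where open ≤-Reasoning

  -- Both windows lie in `[0, n + (x + m))`, whose part from `n` on contributes nothing. This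
  -- permits sums whose range overshoots the finite word.
  ∑-support : ∀ f n → (∀ i → n ≤ i → f i ≡ 0) → ∀ x m → ∑ f x m ≤ ∑ f 0 n
  ∑-support f n f≡0 x m = begin
    ∑ f x m                     ≤⟨ ∑-⊆ f x m (n + (x + m)) (m≤n+m (x + m) n) ⟩
    ∑ f 0 (n + (x + m))         ≡⟨ ∑-++ f 0 n (x + m) ⟩
    ∑ f 0 n + ∑ f n (x + m)     ≡⟨ cong (∑ f 0 n +_) (∑-zero f n (x + m) f≡0) ⟩
    ∑ f 0 n + 0                 ≡⟨ +-identityʳ _ ⟩
    ∑ f 0 n                     ∎
    where open ≤-Reasoning

  ∑-member : ∀ f x n {i} → x ≤ i → i < x + n → f i ≤ ∑ f x n
  ∑-member f x zero    {i} x≤i i<x+0 =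
    contradiction (subst (i <_) (+-identityʳ x) i<x+0) (≤⇒≯ x≤i)
  ∑-member f x (suc n) {i} x≤i i<x+n with m≤n⇒m<n∨m≡n x≤i
  ... | inj₁ x<i  = ≤-trans (∑-member f (suc x) n x<i (subst (i <_) (+-suc x n) i<x+n)) (m≤n+m _ (f x))
  ... | inj₂ refl = m≤m+n (f x) _

  sum-map-applyUpTo : ∀ (f g : ℕ → ℕ) n → sum (map f (applyUpTo g n)) ≡ ∑ (f ∘ g) 0 n
  sum-map-applyUpTo f g zero    = refl
  sum-map-applyUpTo f g (suc n) = cong (f (g 0) +_)
    (trans (sum-map-applyUpTo f (g ∘ suc) n) (∑-shift (f ∘ g) 1 0 n))

  sum-map-upTo : ∀ f n → sum (map f (upTo n)) ≡ ∑ f 0 n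
  sum-map-upTo f n = sum-map-applyUpTo f id n

  sum-concatMap : ∀ {A : Set} (f : A → List ℕ) xs → sum (concatMap f xs) ≡ sum (map (sum ∘ f) xs)
  sum-concatMap f []       = refl
  sum-concatMap f (x ∷ xs) =
    trans (sum-++ (f x) (concatMap f xs)) (cong (sum (f x) +_) (sum-concatMap f xs))

-- Periods of intervals of an infinite binary word.

module Periods where

  open import Data.Nat
  open import Data.Nat.Properties
  open import Data.Nat.Divisibility
  open import Data.Nat.Induction using (<-rec)
  open import Data.Bool using (Bool; T)
  open import Data.Bool.Properties using (T?)
  open import Data.Product using (∃; _×_; _,_)
  open import Function using (_∘_)
  open import Relation.Nullary using (¬_; yes; no; contradiction)
  open import Relation.Binary.PropositionalEquality

  least : (P : ℕ → Bool) → ∀ m → T (P m) → ∃ λ q → q ≤ m × T (P q) × (∀ r → r < q → ¬ T (P r))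
  least P zero    Pm = 0 , z≤n , Pm , λ _ ()
  least P (suc m) Pm with T? (P 0)
  ... | yes P0 = 0 , z≤n , P0 , λ _ ()
  ... | no ¬P0 with least (P ∘ suc) m Pm
  ...   | q , q≤m , Pq , below = suc q , s≤s q≤m , Pq , λ where
          zero    _         → ¬P0
          (suc r) (s≤s r<q) → below r r<q

  -- Logical counterpart of `hasPeriod`. The word is infinite, so no position arising in the
  -- periodicity arguments needs a range check.
  Period : (ℕ → Bool) → ℕ → ℕ → ℕ → Set
  Period u i j p = ∀ t → i ≤ t → t + p ≤ j → u t ≡ u (t + p)

  -- One Euclidean step, the larger period being written `q + r`. An interval at least as long as
  -- the sum of both periods always has room, from `t`, for a jump `q + r` forward followed by `q`
  -- back, or for the same two jumps in the other order.
  Period-∸ : ∀ {u i j} q r → i + (q + r + q) ≤ suc j →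
             Period u i j (q + r) → Period u i j q → Period u i j r
  Period-∸ {u} {i} {j} q r long per per′ t i≤t t+r≤j with t + (q + r) ≤? j
  ... | yes in-range = trans (per t i≤t in-range) (trans (cong u (sym t+r+q)) (sym (per′ (t + r) i≤t+r
                         (subst (_≤ j) (sym t+r+q) in-range))))
    where
    t+r+q : t + r + q ≡ t + (q + r)
    t+r+q = trans (+-assoc t r q) (cong (t +_) (+-comm r q))
    i≤t+r : i ≤ t + r
    i≤t+r = ≤-trans i≤t (m≤m+n t r)
  ... | no out-of-range = trans (sym back) there
    where
    i+q≤t : i + q ≤ t
    i+q≤t = +-cancelʳ-≤ (q + r) (i + q) t (begin
      i + q + (q + r)   ≡⟨ +-assoc i q (q + r) ⟩
      i + (q + (q + r)) ≡⟨ cong (i +_) (+-comm q (q + r)) ⟩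
      i + (q + r + q)   ≤⟨ long ⟩
      suc j             ≤⟨ ≰⇒> out-of-range ⟩
      t + (q + r)       ∎)
      where open ≤-Reasoning
    q≤t : q ≤ t
    q≤t = ≤-trans (m≤n+m q i) i+q≤t
    i≤t∸q : i ≤ t ∸ q
    i≤t∸q = m+n≤o⇒m≤o∸n i i+q≤t
    t∸q+q : t ∸ q + q ≡ t
    t∸q+q = m∸n+n≡m q≤t
    t∸q+q+r : t ∸ q + (q + r) ≡ t + r
    t∸q+q+r = trans (sym (+-assoc (t ∸ q) q r)) (cong (_+ r) t∸q+q)
    back : u (t ∸ q) ≡ u t
    back = trans (per′ (t ∸ q) i≤t∸q (subst (_≤ j) (sym t∸q+q) (m+n≤o⇒m≤o t t+r≤j))) (cong u t∸q+q)
    there : u (t ∸ q) ≡ u (t + r)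
    there = trans (per (t ∸ q) i≤t∸q (subst (_≤ j) (sym t∸q+q+r) t+r≤j)) (cong u t∸q+q+r)

  Period-* : ∀ {u i j q} m → Period u i j q → Period u i j (m * q)
  Period-* {u} {q = q} zero    per t i≤t t+0≤j = cong u (sym (+-identityʳ t))
  Period-* {u} {i} {j} {q} (suc m) per t i≤t t+mq≤j = trans
    (per t i≤t (≤-trans (m≤m+n (t + q) (m * q)) shifted≤j))
    (trans (Period-* m per (t + q) (≤-trans i≤t (m≤m+n t q)) shifted≤j) (cong u (+-assoc t q (m * q))))
    where
    shifted≤j : t + q + m * q ≤ j
    shifted≤j = subst (_≤ j) (sym (+-assoc t q (m * q))) t+mq≤j

  Period-∣ : ∀ {u i j p q} → q ∣ p → Period u i j q → Period u i j p
  Period-∣ (divides-refl m) per = Period-* m per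

  -- The weak form of the Fine–Wilf theorem, by the subtractive Euclidean algorithm.
  least-period-∣ : ∀ {u i j q} → 1 ≤ q → Period u i j q →
                   (∀ r → 1 ≤ r → r < q → ¬ Period u i j r) →
                   ∀ p → i + (p + q) ≤ suc j → Period u i j p → q ∣ p
  least-period-∣ {u} {i} {j} {q} 1≤q per-q minimal = <-rec _ step
    where
    step : ∀ p → (∀ {r} → r < p → i + (r + q) ≤ suc j → Period u i j r → q ∣ r) →
           i + (p + q) ≤ suc j → Period u i j p → q ∣ p
    step zero        rec long per = q ∣0
    step p@(suc _)   rec long per with q ≤? p
    -- Since `q` is the least positive period, the algorithm never swaps its arguments: it subtracts
    -- `q` repeatedly, and a positive remainder below `q` is impossible.
    ... | no  q≰p = contradiction per (minimal p (s≤s z≤n) (≰⇒> q≰p))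
    ... | yes q≤p = subst (q ∣_) q+r≡p (∣m∣n⇒∣m+n ∣-refl (rec r<p
            (≤-trans (+-monoʳ-≤ i (+-monoˡ-≤ q (m∸n≤m p q))) long)
            (Period-∸ {u} q (p ∸ q) (subst (λ s → i + (s + q) ≤ suc j) (sym q+r≡p) long)
              (subst (Period u i j) (sym q+r≡p) per) per-q)))
      where
      q+r≡p : q + (p ∸ q) ≡ p
      q+r≡p = m+[n∸m]≡n q≤p
      r<p : p ∸ q < p
      r<p = ∸-monoʳ-< 1≤q q≤p

-- Finite prefixes of a binary word and recognition of their runs.

module BinaryWords where

  open RangeSum
  open Periods
  open import Data.Nat
  open import Data.Nat.Properties
  open import Data.Bool using (Bool; true; false; T; not; _∧_; _∨_; _xor_; if_then_else_)
  open import Data.Bool.Properties using (T-∧; T-∨; T-≡)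
  open import Data.Fin as Fin using (Fin; toℕ)
  open import Data.Vec using (Vec; tabulate)
  open import Data.Maybe using (just)
  open import Data.List using (map; upTo)
  open import Data.List.Properties using (map-cong)
  open import Data.Nat.ListAction using (sum)
  open import Data.List.Membership.Propositional using (_∈_; lose)
  open import Data.List.Membership.Propositional.Properties using (∈-map⁺; ∈-map⁻; ∈-upTo⁺; ∈-upTo⁻)
  open import Data.List.Relation.Unary.All as All using (All)
  open import Data.List.Relation.Unary.All.Properties using (all⁺; all⁻)
  open import Data.List.Relation.Unary.Any.Properties using (any⁺)
  open import Data.Product using (_×_; _,_; proj₁; proj₂)
  open import Data.Sum using (inj₂)
  open import Data.Unit using (tt)
  open import Function using (_∘_)
  open import Function.Bundles using (Equivalence)
  open import Relation.Nullary using (¬_; contradiction)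
  open import Relation.Nullary.Decidable using (⌊_⌋)
  open import Relation.Binary.PropositionalEquality
  open Equivalence using (to; from)

  m<o∸n⇒m+n<o : ∀ m n {o} → m < o ∸ n → m + n < o
  m<o∸n⇒m+n<o m zero            m<o = subst (_< _) (sym (+-identityʳ m)) m<o
  m<o∸n⇒m+n<o m (suc n) {suc o} m<o = subst (_< suc o) (sym (+-suc m n)) (s≤s (m<o∸n⇒m+n<o m n m<o))

  infixr 4 _∧ᵀ_
  _∧ᵀ_ : ∀ {x y} → T x → T y → T (x ∧ y)
  p ∧ᵀ q = from T-∧ (p , q)

  not⁺ : ∀ {x} → ¬ T x → T (not x)
  not⁺ {true}  ¬x = ¬x tt
  not⁺ {false} ¬x = tt

  mismatch : (ℕ → Bool) → ℕ → ℕ → Bool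
  mismatch u p x = u x xor u (x + p)

  xor-false : ∀ x y → x xor y ≡ false → x ≡ y
  xor-false true  true  _ = refl
  xor-false false false _ = refl

  xor-true : ∀ x y → x xor y ≡ true → x ≢ y
  xor-true true  true  () _
  xor-true false false () _

  bit : Bool → Fin 2
  bit false = Fin.zero
  bit true  = Fin.suc Fin.zero

  ⌊bit≟bit⌋⁺ : ∀ x y → x ≡ y → T ⌊ bit x Fin.≟ bit y ⌋
  ⌊bit≟bit⌋⁺ true  .true  refl = tt
  ⌊bit≟bit⌋⁺ false .false refl = tt

  ⌊bit≟bit⌋⁻ : ∀ x y → T ⌊ bit x Fin.≟ bit y ⌋ → x ≡ y
  ⌊bit≟bit⌋⁻ true  true  _ = refl
  ⌊bit≟bit⌋⁻ false false _ = refl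

  prefix : (ℕ → Bool) → ∀ n → Vec (Fin 2) n
  prefix u n = tabulate (bit ∘ u ∘ toℕ)

  at-prefix : ∀ u n t → t < n → at (prefix u n) t ≡ just (bit (u t))
  at-prefix u (suc n) zero    _         = refl
  at-prefix u (suc n) (suc t) (s≤s t<n) = at-prefix (u ∘ suc) n t t<n

  module _ (u : ℕ → Bool) (n : ℕ) where

    private
      w : Vec (Fin 2) n
      w = prefix u n

    sameSym⁺ : ∀ {s t} → s < n → t < n → u s ≡ u t → T (sameSym (at w s) (at w t))
    sameSym⁺ {s} {t} s<n t<n us≡ut
      rewrite at-prefix u n s s<n | at-prefix u n t t<n = ⌊bit≟bit⌋⁺ (u s) (u t) us≡ut

    sameSym⁻ : ∀ {s t} → s < n → t < n → T (sameSym (at w s) (at w t)) → u s ≡ u t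
    sameSym⁻ {s} {t} s<n t<n same
      rewrite at-prefix u n s s<n | at-prefix u n t t<n = ⌊bit≟bit⌋⁻ (u s) (u t) same

    hasPeriod⁺ : ∀ {i j p} → j < n → Period u i j p → T (hasPeriod w i j p)
    hasPeriod⁺ {i} {j} {p} j<n per = all⁻ _ (All.tabulate same)
      where
      same : ∀ {x} → x ∈ map (i +_) (upTo (suc j ∸ i ∸ p)) → T (sameSym (at w x) (at w (x + p)))
      same x∈ with ∈-map⁻ (i +_) x∈
      ... | t , t∈ , refl = sameSym⁺ (≤-<-trans (m+n≤o⇒m≤o (i + t) in-range) j<n)
                                     (≤-<-trans in-range j<n) (per (i + t) (m≤m+n i t) in-range)
        where
        in-range : i + t + p ≤ j
        in-range = subst (_≤ j) (trans (+-comm (t + p) i) (sym (+-assoc i t p)))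
          (s≤s⁻¹ (m<o∸n⇒m+n<o (t + p) i (m<o∸n⇒m+n<o t p (∈-upTo⁻ t∈))))

    hasPeriod⁻ : ∀ {i j p} → j < n → T (hasPeriod w i j p) → Period u i j p
    hasPeriod⁻ {i} {j} {p} j<n has t i≤t t+p≤j =
      sameSym⁻ (≤-<-trans (m+n≤o⇒m≤o t t+p≤j) j<n) (≤-<-trans t+p≤j j<n)
        (All.lookup (all⁺ _ _ has)
          (subst (_∈ map (i +_) (upTo (suc j ∸ i ∸ p))) (m+[n∸m]≡n i≤t) (∈-map⁺ (i +_) (∈-upTo⁺ t∸i<))))
      where
      open ≤-Reasoning
      t∸i< : t ∸ i < suc j ∸ i ∸ p
      t∸i< = m+n≤o⇒m≤o∸n (suc (t ∸ i)) (m+n≤o⇒m≤o∸n (suc (t ∸ i) + p) (begin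
        suc (t ∸ i + p + i)   ≡⟨ cong suc (+-assoc (t ∸ i) p i) ⟩
        suc (t ∸ i + (p + i)) ≡⟨ cong (λ s → suc (t ∸ i + s)) (+-comm p i) ⟩
        suc (t ∸ i + (i + p)) ≡⟨ cong suc (+-assoc (t ∸ i) i p) ⟨
        suc (t ∸ i + i + p)   ≡⟨ cong (λ s → suc (s + p)) (m∸n+n≡m i≤t) ⟩
        suc (t + p)           ≤⟨ s≤s t+p≤j ⟩
        suc j                 ∎))

    isRunOfPeriod⁻ : ∀ {i j p} → j < n → T (isRunOfPeriod w i j p) → Period u i j p
    isRunOfPeriod⁻ {i} {j} {p} j<n r =
      hasPeriod⁻ j<n (proj₁ (to T-∧ (proj₂ (to (T-∧ {1 ≤ᵇ p}) (proj₁ (to T-∧ (proj₂ (to (T-∧ {i ≤ᵇ j}) r))))))))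

    -- The boolean test asks for the minimum period, whereas `p` is just some period. Starting at
    -- `suc i` with `suc j < n` guarantees a letter on each side, and the two mismatches at distance
    -- `p` involve exactly these letters.
    isRunIn⁺ : ∀ i j p → suc i ≤ j → suc j < n → suc i + (p + p) ≤ suc j →
               Period u (suc i) j p → u i ≢ u (i + p) → u (suc j ∸ p) ≢ u (suc j) →
               T (isRunIn w (suc i) j)
    isRunIn⁺ i j zero    _ _ _ _ u≢ _ = contradiction (cong u (sym (+-identityʳ i))) u≢
    isRunIn⁺ i j p@(suc p′) i<j sj<n long per u≢ u≢′
      -- The search is shifted by `suc` because 0 is a period of every interval.
      with least (hasPeriod w (suc i) j ∘ suc) p′ (hasPeriod⁺ (<⇒≤ sj<n) per)
    ... | q′ , q′≤p′ , has-q , below =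
      ≤⇒≤ᵇ i<j ∧ᵀ <⇒<ᵇ j<n ∧ᵀ any⁺ _ (lose {x = q} (∈-map⁺ suc (∈-upTo⁺ q′<)) (is-run ∧ᵀ left ∧ᵀ right))
      where
      open ≤-Reasoning
      q = suc q′
      q≤p : q ≤ p
      q≤p = s≤s q′≤p′
      j<n : j < n
      j<n = <⇒≤ sj<n
      per-q : Period u (suc i) j q
      per-q = hasPeriod⁻ j<n has-q
      q∣p = least-period-∣ {u} (s≤s z≤n) per-q
        (λ where (suc r) _ (s≤s r<q′) per-r → below r r<q′ (hasPeriod⁺ j<n per-r))
        p (≤-trans (+-monoʳ-≤ (suc i) (+-monoʳ-≤ p q≤p)) long) per
      p+p≤ : p + p ≤ suc j ∸ suc i
      p+p≤ = m+n≤o⇒m≤o∸n (p + p) (subst (_≤ suc j) (+-comm (suc i) (p + p)) long)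
      q′< : q′ < suc j ∸ suc i
      q′< = ≤-trans q≤p (≤-trans (m≤m+n p p) p+p≤)
      is-run : T (isRunOfPeriod w (suc i) j q)
      is-run = ≤⇒≤ᵇ i<j ∧ᵀ (has-q ∧ᵀ all⁻ _ (All.tabulate not-below))
        ∧ᵀ ≤⇒≤ᵇ (≤-trans (≤-reflexive (cong (q +_) (+-identityʳ q))) (≤-trans (+-mono-≤ q≤p q≤p) p+p≤))
        where
        not-below : ∀ {x} → x ∈ map suc (upTo q′) → T (not (hasPeriod w (suc i) j x))
        not-below x∈ with ∈-map⁻ suc x∈
        ... | r , r∈ , refl = not⁺ (below r (∈-upTo⁻ r∈))
      left : T (not (isRunOfPeriod w i j q))
      left = not⁺ λ r → u≢ (Period-∣ {u} q∣p (isRunOfPeriod⁻ j<n r) i ≤-refl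
        (≤-trans (+-monoʳ-≤ i (m≤m+n p p)) (s≤s⁻¹ long)))
      right : T ((suc j ≡ᵇ n) ∨ not (isRunOfPeriod w (suc i) (suc j) q))
      right = from (T-∨ {suc j ≡ᵇ n}) (inj₂ (not⁺ λ r → u≢′ (trans
        (Period-∣ {u} q∣p (isRunOfPeriod⁻ {suc i} sj<n r) (suc j ∸ p)
          (m+n≤o⇒m≤o∸n (suc i) i+p≤) (≤-reflexive sj∸p+p))
        (cong u sj∸p+p))))
        where
        i+p≤ : suc i + p ≤ suc j
        i+p≤ = ≤-trans (+-monoʳ-≤ (suc i) (m≤m+n p p)) long
        sj∸p+p : suc j ∸ p + p ≡ suc j
        sj∸p+p = m∸n+n≡m (m+n≤o⇒n≤o (suc i) i+p≤)

    runIndicator : ℕ → ℕ → ℕ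
    runIndicator i j = if isRunIn w i j then 1 else 0

    run-∑ : run w ≡ ∑ (λ i → ∑ (runIndicator i) 0 n) 0 n
    run-∑ = trans (sum-concatMap (λ i → map (runIndicator i) (upTo n)) (upTo n))
      (trans (cong sum (map-cong (λ i → sum-map-upTo (runIndicator i) n) (upTo n)))
        (sum-map-upTo _ n))

    runIndicator-out : ∀ i j → ¬ (i ≤ j × j < n) → runIndicator i j ≡ 0
    runIndicator-out i j out with isRunIn w i j in eq
    ... | false = refl
    ... | true  with to (T-∧ {i ≤ᵇ j}) (from T-≡ eq)
    ...   | i≤j , rest = contradiction (≤ᵇ⇒≤ i j i≤j , <ᵇ⇒< j n (proj₁ (to T-∧ rest))) out

    runIndicator-run : ∀ {i j} → T (isRunIn w i j) → runIndicator i j ≡ 1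
    runIndicator-run {i} {j} r rewrite to T-≡ r = refl

    -- Reindexes the runs by start `i` and length minus one `s`. The ranges `m` and `l` are
    -- arbitrary, since `runIndicator` vanishes outside the word; distinct pairs `(i , s)` give
    -- distinct pairs of positions.
    ∑-runIndicator≤run : ∀ m l → ∑ (λ i → ∑ (λ s → runIndicator i (i + s)) 0 l) 0 m ≤ run w
    ∑-runIndicator≤run m l = begin
      ∑ (λ i → ∑ (λ s → runIndicator i (i + s)) 0 l) 0 m ≤⟨ ∑-mono row≤ 0 m ⟩
      ∑ (λ i → ∑ (runIndicator i) 0 n) 0 m               ≤⟨ ∑-support _ n column-out 0 m ⟩
      ∑ (λ i → ∑ (runIndicator i) 0 n) 0 n               ≡⟨ run-∑ ⟨
      run w                                              ∎
      where
      open ≤-Reasoning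
      row≤ : ∀ i → ∑ (λ s → runIndicator i (i + s)) 0 l ≤ ∑ (runIndicator i) 0 n
      row≤ i = ≤-trans (≤-reflexive (∑-shift (runIndicator i) i 0 l))
        (∑-support (runIndicator i) n (λ j n≤j → runIndicator-out i j (λ (_ , j<n) → <⇒≱ j<n n≤j))
          (i + 0) l)
      column-out : ∀ i → n ≤ i → ∑ (runIndicator i) 0 n ≡ 0
      column-out i n≤i = ∑-zero (runIndicator i) 0 n
        (λ j _ → runIndicator-out i j (λ (i≤j , j<n) → <⇒≱ j<n (≤-trans n≤i i≤j)))

    -- A maximal block of k matches at distance p that follows a mismatch at i
    -- is a run of length k + p starting at suc i.
    mismatch-run : ∀ {i k p s} → p ≤ k → suc s ≡ k + p → suc i + (k + p) < n →
                   mismatch u p i ≡ true →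
                   (∀ t → t < k → mismatch u p (suc i + t) ≡ false) →
                   mismatch u p (suc i + k) ≡ true →
                   runIndicator (suc i) (suc i + s) ≡ 1
    mismatch-run {i} {k} {p} {s} p≤k ss≡k+p <n before inside after = runIndicator-run {suc i} {suc i + s}
      (isRunIn⁺ i (suc i + s) p (m≤m+n (suc i) s) (subst (_< n) (sym end) <n)
        (subst (suc i + (p + p) ≤_) (sym end) (+-monoʳ-≤ (suc i) (+-monoˡ-≤ p p≤k)))
        per (xor-true _ _ before) (xor-true′ after))
      where
      end : suc (suc i + s) ≡ suc i + (k + p)
      end = trans (sym (+-suc (suc i) s)) (cong (suc i +_) ss≡k+p)
      end′ : suc i + (k + p) ≡ suc i + k + p
      end′ = sym (+-assoc (suc i) k p)
      per : Period u (suc i) (suc i + s) p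
      per t i<t t+p≤ = xor-false _ _ (subst (λ x → mismatch u p x ≡ false) (m+[n∸m]≡n i<t)
        (inside (t ∸ suc i) (+-cancelˡ-< (suc i) _ _ (subst (_< suc i + k) (sym (m+[n∸m]≡n i<t))
          (+-cancelʳ-< p t (suc i + k) (subst (t + p <_) (trans end end′) (s≤s t+p≤)))))))
      xor-true′ : mismatch u p (suc i + k) ≡ true → u (suc (suc i + s) ∸ p) ≢ u (suc (suc i + s))
      xor-true′ m rewrite end | end′ | m+n∸n≡m (suc i + k) p = xor-true _ _ m

-- Counting the runs of a periodic word by scanning mismatches.

module Counting where

  open RangeSum
  open BinaryWords
  open import Data.Nat
  open import Data.Nat.Properties
  open import Data.Nat.DivMod using (_%_; [m+kn]%n≡m%n; m<n⇒m%n≡m)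
  open import Data.Bool using (Bool; true; false; T; _∧_; _xor_; if_then_else_)
  open import Data.Bool.Properties using (T-∧)
  open import Data.List using (List; []; _∷_; _++_; length; take; drop; zipWith)
  open import Data.List.Properties using (length-take)
  open import Data.Product using (_×_; _,_)
  open import Data.Sum using (inj₁; inj₂)
  open import Data.Unit using (⊤; tt)
  open import Function.Bundles using (Equivalence)
  open import Relation.Binary.PropositionalEquality

  good : (p lo hi k : ℕ) → Bool
  good p lo hi k = (p ≤ᵇ k) ∧ (lo <ᵇ k + p) ∧ (k + p ≤ᵇ hi)

  -- `k` is the number of matches since the last mismatch. A block still open at the end of the list
  -- is not counted, so cutting a list short can only lower the result.
  scan : (p lo hi k : ℕ) → List Bool → ℕ
  scan p lo hi k []           = 0
  scan p lo hi k (false ∷ ms) = scan p lo hi (suc k) ms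
  scan p lo hi k (true  ∷ ms) = (if good p lo hi k then 1 else 0) + scan p lo hi 0 ms

  -- Synchronises at the first mismatch and reads one cycle of length L from there.
  scanCycle : (L p lo hi : ℕ) → List Bool → ℕ
  scanCycle L p lo hi []           = 0
  scanCycle L p lo hi (false ∷ ms) = scanCycle L p lo hi ms
  scanCycle L p lo hi (true  ∷ ms) = scan p lo hi 0 (take L ms)

  -- A row (p , v) counts, for lo the sum of the preceding widths, the maximal
  -- repetitions of period p whose length lies in the half-open interval
  -- (lo, lo + v]. A length thus determines the row that counts it, so no run is
  -- counted twice although p is never checked to be the minimum period.
  count : (L : ℕ) → List Bool → ℕ → List (ℕ × ℕ) → ℕ
  count L V lo []               = 0
  count L V lo ((p , v) ∷ rows) =
    scanCycle L p lo (lo + v) (zipWith _xor_ V (drop p V)) + count L V (lo + v) rows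

  width : List (ℕ × ℕ) → ℕ
  width []               = 0
  width ((p , v) ∷ rows) = v + width rows

  -- Links the lists, which evaluation traverses in one pass, to the function on which periods and
  -- runs are stated.
  Spells : (ℕ → Bool) → ℕ → List Bool → Set
  Spells u x []       = ⊤
  Spells u x (a ∷ as) = u x ≡ a × Spells u (suc x) as

  Spells-++ : ∀ u x as {bs} → Spells u x as → Spells u (x + length as) bs → Spells u x (as ++ bs)
  Spells-++ u x []       {bs} _         sbs = subst (λ y → Spells u y bs) (+-identityʳ x) sbs
  Spells-++ u x (a ∷ as) {bs} (e , sas) sbs =
    e , Spells-++ u (suc x) as sas (subst (λ y → Spells u y bs) (+-suc x (length as)) sbs)

  Spells-drop : ∀ u x p as → Spells u x as → Spells u (x + p) (drop p as)
  Spells-drop u x zero    as       s       = subst (λ y → Spells u y as) (sym (+-identityʳ x)) s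
  Spells-drop u x (suc p) []       s       = tt
  Spells-drop u x (suc p) (a ∷ as) (_ , s) =
    subst (λ y → Spells u y (drop p as)) (sym (+-suc x p)) (Spells-drop u (suc x) p as s)

  Spells-take : ∀ u x l as → Spells u x as → Spells u x (take l as)
  Spells-take u x zero    as       s       = tt
  Spells-take u x (suc l) []       s       = tt
  Spells-take u x (suc l) (a ∷ as) (e , s) = e , Spells-take u (suc x) l as s

  Spells-mismatch : ∀ u p x as bs → Spells u x as → Spells u (x + p) bs →
                    Spells (mismatch u p) x (zipWith _xor_ as bs)
  Spells-mismatch u p x []       bs       _       _        = tt
  Spells-mismatch u p x (a ∷ as) []       _       _        = tt
  Spells-mismatch u p x (a ∷ as) (b ∷ bs) (e , s) (e′ , s′) =
    cong₂ _xor_ e e′ , Spells-mismatch u p (suc x) as bs s s′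

  Spells-shift : ∀ u L → (∀ x → u (x + L) ≡ u x) → ∀ x as → Spells u x as → Spells u (x + L) as
  Spells-shift u L periodic x []       _       = tt
  Spells-shift u L periodic x (a ∷ as) (e , s) = trans (periodic x) e , Spells-shift u L periodic (suc x) as s

  length-zipWith-≤ : ∀ (f : Bool → Bool → Bool) as bs → length (zipWith f as bs) ≤ length as
  length-zipWith-≤ f []       bs       = z≤n
  length-zipWith-≤ f (a ∷ as) []       = z≤n
  length-zipWith-≤ f (a ∷ as) (b ∷ bs) = s≤s (length-zipWith-≤ f as bs)

  module _ (d : ℕ → Bool) (g : ℕ → ℕ) (p lo hi E : ℕ)
           (counted : ∀ i k → i + k < E → T (good p lo hi k) → d i ≡ true →
                      (∀ t → t < k → d (suc i + t) ≡ false) → d (suc i + k) ≡ true →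
                      1 ≤ g (suc i)) where

    -- Each good block is charged to its starting position, and different blocks start at different
    -- positions. The invariant is that `i` is the last mismatch and that `k` matches have followed
    -- it.
    scan-≤ : ∀ i k ms → d i ≡ true → (∀ t → t < k → d (suc i + t) ≡ false) →
             Spells d (suc i + k) ms → i + k + length ms ≤ E →
             scan p lo hi k ms ≤ ∑ g (suc i) (k + length ms)
    scan-≤ i k []           before inside _       _   = z≤n
    scan-≤ i k (false ∷ ms) before inside (e , s) ≤E =
      subst (λ l → scan p lo hi (suc k) ms ≤ ∑ g (suc i) l) (sym (+-suc k (length ms)))
        (scan-≤ i (suc k) ms before inside′ (subst (λ y → Spells d y ms) (sym (+-suc (suc i) k)) s)
          (subst (_≤ E) (trans (+-suc (i + k) (length ms)) (cong (_+ length ms) (sym (+-suc i k)))) ≤E))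
      where
      inside′ : ∀ t → t < suc k → d (suc i + t) ≡ false
      inside′ t (s≤s t≤k) with m≤n⇒m<n∨m≡n t≤k
      ... | inj₁ t<k  = inside t t<k
      ... | inj₂ refl = e
    scan-≤ i k (true ∷ ms) before inside (e , s) ≤E = begin
      (if good p lo hi k then 1 else 0) + scan p lo hi 0 ms
        -- The mismatch at `suc i + k` closes this block and also opens the next one, so the window
        -- is cut after `suc k` positions.
        ≤⟨ +-mono-≤ first rest ⟩
      ∑ g (suc i) (suc k) + ∑ g (suc i + suc k) (length ms)
        ≡⟨ ∑-++ g (suc i) (suc k) (length ms) ⟨
      ∑ g (suc i) (suc k + length ms)
        ≡⟨ cong (∑ g (suc i)) (+-suc k (length ms)) ⟨
      ∑ g (suc i) (k + suc (length ms)) ∎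
      where
      open ≤-Reasoning
      end : suc (i + k + length ms) ≤ E
      end = subst (_≤ E) (+-suc (i + k) (length ms)) ≤E
      first : (if good p lo hi k then 1 else 0) ≤ ∑ g (suc i) (suc k)
      first with good p lo hi k in eq
      ... | false = z≤n
      ... | true  = ≤-trans (counted i k (≤-trans (s≤s (m≤m+n (i + k) (length ms))) end)
                              (subst T (sym eq) tt) before inside e) (m≤m+n (g (suc i)) _)
      rest : scan p lo hi 0 ms ≤ ∑ g (suc i + suc k) (length ms)
      rest = subst (λ x → scan p lo hi 0 ms ≤ ∑ g x (length ms)) (sym (+-suc (suc i) k))
        (scan-≤ (suc i + k) 0 ms e (λ _ ())
          (subst (λ y → Spells d y ms) (sym (cong suc (+-identityʳ (suc i + k)))) s)
          (subst (λ y → y + length ms ≤ E) (sym (+-identityʳ (suc i + k))) end))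

    module _ (L : ℕ) (periodic : ∀ x → d (x + L) ≡ d x) where

      -- By periodicity `o + L` is again a mismatch followed by the same list. Each of the `M`
      -- readings is charged inside its own window of `L` positions, and these windows are disjoint.
      scan-cycles-≤ : ∀ M o ms → d o ≡ true → Spells d (suc o) ms → length ms ≤ L → o + M * L ≤ E →
                      M * scan p lo hi 0 ms ≤ ∑ g (suc o) (M * L)
      scan-cycles-≤ zero    o ms at-o s short ≤E = z≤n
      scan-cycles-≤ (suc M) o ms at-o s short ≤E = begin
        scan p lo hi 0 ms + M * scan p lo hi 0 ms
          ≤⟨ +-mono-≤
               (scan-≤ o 0 ms at-o (λ _ ()) (subst (λ y → Spells d (suc y) ms) (sym (+-identityʳ o)) s)
                 (subst (λ y → y + length ms ≤ E) (sym (+-identityʳ o))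
                   (≤-trans (+-monoʳ-≤ o (≤-trans short (m≤m+n L (M * L)))) ≤E)))
               (scan-cycles-≤ M (o + L) ms (trans (periodic o) at-o) (Spells-shift d L periodic (suc o) ms s)
                 short (subst (_≤ E) (sym (+-assoc o L (M * L))) ≤E)) ⟩
        ∑ g (suc o) (length ms) + ∑ g (suc o + L) (M * L)
          -- `ms` may be shorter than a cycle, so its window is padded to length `L`.
          ≤⟨ +-monoˡ-≤ (∑ g (suc o + L) (M * L)) (m≤m+n (∑ g (suc o) (length ms)) _) ⟩
        ∑ g (suc o) (length ms) + ∑ g (suc o + length ms) (L ∸ length ms) + ∑ g (suc o + L) (M * L)
          ≡⟨ cong (_+ ∑ g (suc o + L) (M * L)) (∑-++ g (suc o) (length ms) (L ∸ length ms)) ⟨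
        ∑ g (suc o) (length ms + (L ∸ length ms)) + ∑ g (suc o + L) (M * L)
          ≡⟨ cong (λ l → ∑ g (suc o) l + ∑ g (suc o + L) (M * L)) (m+[n∸m]≡n short) ⟩
        ∑ g (suc o) L + ∑ g (suc o + L) (M * L)
          ≡⟨ ∑-++ g (suc o) L (M * L) ⟨
        ∑ g (suc o) (L + M * L) ∎
        where open ≤-Reasoning

      scanCycle-≤ : ∀ M x ms → Spells d x ms → x + length ms + M * L ≤ E →
                    M * scanCycle L p lo hi ms ≤ ∑ g 0 E
      scanCycle-≤ M x []           _       ≤E = ≤-trans (≤-reflexive (*-zeroʳ M)) z≤n
      scanCycle-≤ M x (false ∷ ms) (_ , s) ≤E =
        scanCycle-≤ M (suc x) ms s (subst (λ y → y + M * L ≤ E) (+-suc x (length ms)) ≤E)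
      scanCycle-≤ M x (true ∷ ms)  (e , s) ≤E = ≤-trans
        (scan-cycles-≤ M x (take L ms) e (Spells-take d (suc x) L ms s)
          (≤-trans (≤-reflexive (length-take L ms)) (m⊓n≤m L (length ms))) (<⇒≤ x+ML<E))
        (∑-⊆ g (suc x) (M * L) E x+ML<E)
        where
        x+ML<E : x + M * L < E
        x+ML<E = ≤-trans (s≤s (+-monoˡ-≤ (M * L) (m≤m+n x (length ms))))
          (subst (λ y → y + M * L ≤ E) (+-suc x (length ms)) ≤E)

  nth : List Bool → ℕ → Bool
  nth []       _       = false
  nth (a ∷ as) zero    = a
  nth (a ∷ as) (suc t) = nth as t

  Spells-nth : ∀ u x as → (∀ t → t < length as → u (x + t) ≡ nth as t) → Spells u x as
  Spells-nth u x []       eq = tt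
  Spells-nth u x (a ∷ as) eq = trans (cong u (sym (+-identityʳ x))) (eq 0 (s≤s z≤n)) ,
    Spells-nth u (suc x) as (λ t t< → trans (cong u (sym (+-suc x t))) (eq (suc t) (s≤s t<)))

  module _ (W : List Bool) .{{_ : NonZero (length W)}} where

    private
      L : ℕ
      L = length W

      -- Three copies suffice for `p ≤ L`: the shift by `p`, the search for the first mismatch and
      -- the full cycle read after it take at most `L` symbols each.
      V : List Bool
      V = W ++ W ++ W

    cyclic : ℕ → Bool
    cyclic x = nth W (x % L)

    cyclic-periodic : ∀ x → cyclic (x + L) ≡ cyclic x
    cyclic-periodic x = cong (nth W) (trans (cong (λ y → (x + y) % L) (sym (*-identityˡ L))) ([m+kn]%n≡m%n x 1 L))

    mismatch-periodic : ∀ p x → mismatch cyclic p (x + L) ≡ mismatch cyclic p x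
    mismatch-periodic p x = cong₂ _xor_ (cyclic-periodic x)
      (trans (cong cyclic (trans (+-assoc x L p) (trans (cong (x +_) (+-comm L p)) (sym (+-assoc x p L)))))
        (cyclic-periodic (x + p)))

    Spells-cyclic : Spells cyclic 0 V
    Spells-cyclic = Spells-++ cyclic 0 W once
      (Spells-++ cyclic L W (Spells-shift cyclic L cyclic-periodic 0 W once)
        (Spells-shift cyclic L cyclic-periodic L W (Spells-shift cyclic L cyclic-periodic 0 W once)))
      where
      once : Spells cyclic 0 W
      once = Spells-nth cyclic 0 W (λ t t<L → cong (nth W) (m<n⇒m%n≡m t<L))

    module _ (M n : ℕ) where

      private
        E : ℕ
        E = length V + M * L

        runFrom : ℕ → ℕ → ℕ
        runFrom i s = runIndicator cyclic n i (i + s)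

      -- The charge at `i` is the number of runs starting at `i` whose length lies in the row's
      -- window, so each good block is covered by a charge of at least 1. The bound on `n` leaves
      -- room for the longest such run and for the letter after it.
      row-≤ : ∀ p lo v → E + (lo + v) < n →
              M * scanCycle L p lo (lo + v) (zipWith _xor_ V (drop p V)) ≤ ∑ (λ i → ∑ (runFrom i) lo v) 0 E
      row-≤ p lo v E+<n = scanCycle-≤ (mismatch cyclic p) (λ i → ∑ (runFrom i) lo v) p lo (lo + v) E counted
        L (mismatch-periodic p) M 0 _
        (Spells-mismatch cyclic p 0 V (drop p V) Spells-cyclic (Spells-drop cyclic 0 p V Spells-cyclic))
        (+-monoˡ-≤ (M * L) (length-zipWith-≤ _xor_ V (drop p V)))
        where
        counted : ∀ i k → i + k < E → T (good p lo (lo + v) k) → mismatch cyclic p i ≡ true →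
                  (∀ t → t < k → mismatch cyclic p (suc i + t) ≡ false) →
                  mismatch cyclic p (suc i + k) ≡ true → 1 ≤ ∑ (runFrom (suc i)) lo v
        counted i k i+k<E gd before inside after with Equivalence.to (T-∧ {p ≤ᵇ k}) gd
        ... | p≤ᵇk , gd′ with Equivalence.to (T-∧ {lo <ᵇ k + p}) gd′
        -- `s` is the length minus one: the window `(lo, lo + v]` for lengths becomes `[lo, lo + v)`
        -- for `s`, which is the range of the sum.
        ...   | lo<ᵇ , ≤ᵇhi with k + p in eq | <ᵇ⇒< lo (k + p) lo<ᵇ | ≤ᵇ⇒≤ (k + p) (lo + v) ≤ᵇhi
        ...     | suc s | s≤s lo≤s | s<hi = begin
          1                        ≡⟨ mismatch-run cyclic n {i} {k} {p} {s} (≤ᵇ⇒≤ p k p≤ᵇk) (sym eq) <n before inside after ⟨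
          runFrom (suc i) s        ≤⟨ ∑-member (runFrom (suc i)) lo v lo≤s s<hi ⟩
          ∑ (runFrom (suc i)) lo v ∎
          where
          open ≤-Reasoning
          <n : suc i + (k + p) < n
          <n = ≤-<-trans (+-mono-≤ (≤-trans (s≤s (m≤m+n i k)) i+k<E) (subst (_≤ lo + v) (sym eq) s<hi)) E+<n

      -- The rows occupy consecutive length windows, so at each start their sums join into a single
      -- sum. This is where runs found for different rows are kept distinct.
      count-≤ : ∀ lo rows → E + (lo + width rows) < n →
                M * count L V lo rows ≤ ∑ (λ i → ∑ (runFrom i) lo (width rows)) 0 E
      count-≤ lo []               E+<n = ≤-trans (≤-reflexive (*-zeroʳ M)) z≤n
      count-≤ lo ((p , v) ∷ rows) E+<n = begin
        M * (c + count L V (lo + v) rows)     ≡⟨ *-distribˡ-+ M c _ ⟩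
        M * c + M * count L V (lo + v) rows
          ≤⟨ +-mono-≤ (row-≤ p lo v (≤-<-trans (+-monoʳ-≤ E (+-monoʳ-≤ lo (m≤m+n v (width rows)))) E+<n))
                      (count-≤ (lo + v) rows (subst (λ l → E + l < n) (sym (+-assoc lo v (width rows))) E+<n)) ⟩
        ∑ (λ i → ∑ (runFrom i) lo v) 0 E + ∑ (λ i → ∑ (runFrom i) (lo + v) (width rows)) 0 E
          ≡⟨ ∑-+ _ _ 0 E ⟨
        ∑ (λ i → ∑ (runFrom i) lo v + ∑ (runFrom i) (lo + v) (width rows)) 0 E
          ≤⟨ ∑-mono (λ i → ≤-reflexive (sym (∑-++ (runFrom i) lo v (width rows)))) 0 E ⟩
        ∑ (λ i → ∑ (runFrom i) lo (v + width rows)) 0 E ∎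
        where
        open ≤-Reasoning
        c : ℕ
        c = scanCycle L p lo (lo + v) (zipWith _xor_ V (drop p V))

      run-cyclic-≥ : ∀ rows → E + width rows < n → M * count L V 0 rows ≤ run (prefix cyclic n)
      run-cyclic-≥ rows E+<n = ≤-trans (count-≤ 0 rows E+<n) (∑-runIndicator≤run cyclic n E (width rows))

-- Clearing denominators in the rational inequality.

module RationalBounds where

  open import Data.Nat as ℕ using (ℕ; suc)
  open import Data.Nat.Properties as ℕ using ()
  open import Data.Integer as ℤ using (+_; +[1+_]; -[1+_])
  open import Data.Integer.Properties as ℤ using ()
  open import Data.Integer.Solver using (module +-*-Solver)
  open import Data.Rational
  open import Data.Rational.Properties using (toℚᵘ-homo-+; toℚᵘ-homo-*; toℚᵘ-homo‿-; toℚᵘ-fromℚᵘ; toℚᵘ-cancel-<)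
  open import Data.Rational.Unnormalised as ℚᵘ using (mkℚᵘ)
  open import Data.Rational.Unnormalised.Properties as ℚᵘ using ()
  open import Relation.Binary.PropositionalEquality

  toℚᵘ-[a/b-ε]n : ∀ a b-1 ε n → toℚᵘ (((+ a / suc b-1) - ε) * (+ n / 1)) ℚᵘ.≃
                  (mkℚᵘ (+ a) b-1 ℚᵘ.- toℚᵘ ε) ℚᵘ.* mkℚᵘ (+ n) 0
  toℚᵘ-[a/b-ε]n a b-1 ε n = ℚᵘ.≃-trans (toℚᵘ-homo-* ((+ a / suc b-1) - ε) (+ n / 1))
    (ℚᵘ.*-cong
      (ℚᵘ.≃-trans (toℚᵘ-homo-+ (+ a / suc b-1) (- ε))
        (ℚᵘ.+-cong (toℚᵘ-fromℚᵘ (mkℚᵘ (+ a) b-1)) (toℚᵘ-homo‿- ε)))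
      (toℚᵘ-fromℚᵘ (mkℚᵘ (+ n) 0)))

  -- A positive `ε` with denominator `d` is at least `1/d`. The hypothesis is the inequality for
  -- `1/d` in place of `ε`, multiplied by `b * d`.
  [a/b-ε]n<r : ∀ a b .{{_ : ℕ.NonZero b}} ε → 0ℚ < ε → ∀ n r →
               a ℕ.* (↧ₙ ε ℕ.* n) ℕ.< b ℕ.* (n ℕ.+ ↧ₙ ε ℕ.* r) →
               ((+ a / b) - ε) * (+ n / 1) < (+ r / 1)
  [a/b-ε]n<r a (suc b-1) ε@(mkℚ (+ 0) d-1 _) (*<* (ℤ.+<+ ())) n r bound
  [a/b-ε]n<r a (suc b-1) ε@(mkℚ -[1+ _ ] d-1 _) (*<* ()) n r bound
  [a/b-ε]n<r a (suc b-1) ε@(mkℚ +[1+ e ] d-1 _) 0<ε n r bound =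
    toℚᵘ-cancel-< (ℚᵘ.<-respʳ-≃ (ℚᵘ.≃-sym (toℚᵘ-fromℚᵘ (mkℚᵘ (+ r) 0)))
      (ℚᵘ.<-respˡ-≃ (ℚᵘ.≃-sym (toℚᵘ-[a/b-ε]n a b-1 ε n)) (ℚᵘ.*<* numerators)))
    where
    open +-*-Solver
    open ℤ.≤-Reasoning
    b d X Y Z : ℕ
    b = suc b-1
    d = suc d-1
    X = a ℕ.* (d ℕ.* n)
    Y = b ℕ.* (suc e ℕ.* n)
    Z = b ℕ.* (d ℕ.* r)
    X<Y+Z : X ℕ.< Y ℕ.+ Z
    X<Y+Z = ℕ.<-≤-trans bound (ℕ.≤-trans (ℕ.≤-reflexive (ℕ.*-distribˡ-+ b n (d ℕ.* r)))
      (ℕ.+-monoˡ-≤ Z (ℕ.*-monoʳ-≤ b (ℕ.m≤m+n n (e ℕ.* n)))))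
    pos-*₃ : ∀ x y z → + (x ℕ.* (y ℕ.* z)) ≡ + x ℤ.* (+ y ℤ.* + z)
    pos-*₃ x y z = trans (ℤ.pos-* x (y ℕ.* z)) (cong (+ x ℤ.*_) (ℤ.pos-* y z))
    numerators : (+ a ℤ.* + d ℤ.+ -[1+ e ] ℤ.* + b) ℤ.* + n ℤ.* + 1 ℤ.< + r ℤ.* + (b ℕ.* d ℕ.* 1)
    numerators = begin-strict
      (+ a ℤ.* + d ℤ.+ -[1+ e ] ℤ.* + b) ℤ.* + n ℤ.* + 1
        ≡⟨ solve 5 (λ a b d e n → (a :* d :+ :- e :* b) :* n :* con (+ 1) := a :* (d :* n) :- b :* (e :* n))
             refl (+ a) (+ b) (+ d) +[1+ e ] (+ n) ⟩
      + a ℤ.* (+ d ℤ.* + n) ℤ.- + b ℤ.* (+[1+ e ] ℤ.* + n)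
        ≡⟨ cong₂ ℤ._-_ (pos-*₃ a d n) (pos-*₃ b (suc e) n) ⟨
      + X ℤ.- + Y
        <⟨ ℤ.+-monoˡ-< (ℤ.- + Y) (ℤ.+<+ X<Y+Z) ⟩
      + (Y ℕ.+ Z) ℤ.- + Y
        ≡⟨ cong (ℤ._- + Y) (ℤ.pos-+ Y Z) ⟩
      + Y ℤ.+ + Z ℤ.- + Y
        ≡⟨ solve 2 (λ y z → y :+ z :- y := z) refl (+ Y) (+ Z) ⟩
      + Z
        ≡⟨ pos-*₃ b d r ⟩
      + b ℤ.* (+ d ℤ.* + r)
        ≡⟨ solve 3 (λ b d r → b :* (d :* r) := r :* (b :* d :* con (+ 1))) refl (+ b) (+ d) (+ r) ⟩
      + r ℤ.* (+ b ℤ.* + d ℤ.* + 1)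
        ≡⟨ cong (λ x → + r ℤ.* (x ℤ.* + 1)) (ℤ.pos-* b d) ⟨
      + r ℤ.* (+ (b ℕ.* d) ℤ.* + 1)
        ≡⟨ cong (+ r ℤ.*_) (ℤ.pos-* (b ℕ.* d) 1) ⟨
      + r ℤ.* + (b ℕ.* d ℕ.* 1) ∎

-- From one cycle to all large lengths.

module Density where

  open BinaryWords
  open Counting
  open RationalBounds
  open import Data.Nat
  open import Data.Nat.Properties
  open import Data.Nat.DivMod using (_/_; _%_; m≡m%n+[m/n]*n; m/n*n≤m; m%n<n)
  open import Data.Nat.Solver using (module +-*-Solver)
  open import Data.Bool using (Bool)
  open import Data.Fin using (Fin)
  import Data.Integer as ℤ
  open import Data.List using (List; length; _++_)
  open import Data.Product using (Σ; _×_; _,_; ∃-syntax)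
  open import Data.Rational as ℚ using (ℚ; 0ℚ; ↧ₙ_)
  open import Data.Vec using (Vec)
  open import Relation.Binary.PropositionalEquality

  -- The cycles balance by `L * a ≤ R * b`. The at most `K` symbols outside them cost `a * (d * K)`,
  -- which is at most `a * n` and hence below `b * n`, the slack granted by `1/d`.
  cycle-arithmetic : ∀ {a b n r} d K L M R → a < b → 1 ≤ n → d * K ≤ n → n ≤ K + M * L →
                     L * a ≤ R * b → M * R ≤ r → a * (d * n) < b * (n + d * r)
  cycle-arithmetic {a} {b} {n} {r} d K L M R a<b 1≤n dK≤n n≤K+ML La≤Rb MR≤r = begin-strict
    a * (d * n)                   ≤⟨ *-monoʳ-≤ a (*-monoʳ-≤ d n≤K+ML) ⟩
    a * (d * (K + M * L))         ≡⟨ solve 5 (λ a d K L M → a :* (d :* (K :+ M :* L)) :=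
                                       a :* (d :* K) :+ d :* M :* (L :* a)) refl a d K L M ⟩
    a * (d * K) + d * M * (L * a) ≤⟨ +-mono-≤ (*-monoʳ-≤ a dK≤n) (*-monoʳ-≤ (d * M) La≤Rb) ⟩
    a * n + d * M * (R * b)       <⟨ +-monoˡ-< (d * M * (R * b)) (*-monoˡ-< n {{>-nonZero 1≤n}} a<b) ⟩
    b * n + d * M * (R * b)       ≡⟨ solve 5 (λ b n d M R → b :* n :+ d :* M :* (R :* b) :=
                                       b :* (n :+ d :* (M :* R))) refl b n d M R ⟩
    b * (n + d * (M * R))         ≤⟨ *-monoʳ-≤ b (+-monoʳ-≤ n (*-monoʳ-≤ d MR≤r)) ⟩
    b * (n + d * r)               ∎
    where
    open ≤-Reasoning
    open +-*-Solver

  -- Length and count enter through equations with `l` and `r`, so the density condition can be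
  -- checked on literals, apart from the evaluation of the word.
  run-density : ∀ a b .{{_ : NonZero b}} (W : List Bool) .{{_ : NonZero (length W)}} rows → a < b →
    ∀ {l r} → length W ≡ l → count (length W) (W ++ W ++ W) 0 rows ≡ r → l * a ≤ r * b →
    (ε : ℚ) → 0ℚ ℚ.< ε →
    ∃[ N ] (1 ≤ N × ((n : ℕ) → N ≤ n →
      ∃[ k ] Σ (Vec (Fin k) n) λ w →
        ((ℤ.+ a ℚ./ b) ℚ.- ε) ℚ.* (ℤ.+ n ℚ./ 1) ℚ.< (ℤ.+ run w ℚ./ 1)))
  run-density a b W rows a<b refl refl dense ε 0<ε = d * K , 1≤dK , λ n dK≤n →
    2 , prefix (cyclic W) n , [a/b-ε]n<r a b ε 0<ε n _
      (cycle-arithmetic d K L ((n ∸ C) / L) R a<b (≤-trans 1≤dK dK≤n) dK≤n (n≤ n (C≤ n dK≤n)) dense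
        (run-cyclic-≥ W ((n ∸ C) / L) n rows (fits n (C≤ n dK≤n))))
    where
    open ≤-Reasoning
    d L R C K : ℕ
    d = ↧ₙ ε
    L = length W
    R = count L (W ++ W ++ W) 0 rows
    -- `C` is the fixed overhead demanded by `run-cyclic-≥`: three copies, the greatest length in
    -- the table, and 1 for strictness. `K` adds one cycle for the remainder of the division by `L`.
    C = suc (length (W ++ W ++ W) + width rows)
    K = C + L
    1≤dK : 1 ≤ d * K
    1≤dK = s≤s z≤n
    C≤ : ∀ n → d * K ≤ n → C ≤ n
    C≤ n dK≤n = ≤-trans (m≤m+n C L) (≤-trans (m≤n*m K d) dK≤n)
    n≤ : ∀ n → C ≤ n → n ≤ K + (n ∸ C) / L * L
    n≤ n C≤n = begin
      n                                         ≡⟨ m+[n∸m]≡n C≤n ⟨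
      C + (n ∸ C)                               ≡⟨ cong (C +_) (m≡m%n+[m/n]*n (n ∸ C) L) ⟩
      C + ((n ∸ C) % L + (n ∸ C) / L * L)       ≤⟨ +-monoʳ-≤ C (+-monoˡ-≤ _ (<⇒≤ (m%n<n (n ∸ C) L))) ⟩
      C + (L + (n ∸ C) / L * L)                 ≡⟨ +-assoc C L _ ⟨
      K + (n ∸ C) / L * L                       ∎
    fits : ∀ n → C ≤ n → length (W ++ W ++ W) + (n ∸ C) / L * L + width rows < n
    fits n C≤n = begin
      suc (length (W ++ W ++ W) + (n ∸ C) / L * L + width rows)
        ≡⟨ solve 3 (λ v m l → con 1 :+ (v :+ m :+ l) := con 1 :+ (v :+ l) :+ m) refl
             (length (W ++ W ++ W)) ((n ∸ C) / L * L) (width rows) ⟩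
      C + (n ∸ C) / L * L
        ≤⟨ +-monoʳ-≤ C (m/n*n≤m (n ∸ C) L) ⟩
      C + (n ∸ C)
        ≡⟨ m+[n∸m]≡n C≤n ⟩
      n ∎
      where open +-*-Solver

-- The word, its table of periods and the evaluation.

module PadovanWord where

  open Counting
  open import Data.Nat
  open import Data.Nat.Properties using (≤ᵇ⇒≤; <ᵇ⇒<)
  open import Data.Bool using (Bool; true; false)
  open import Data.List using (List; []; _∷_; _++_; length; concatMap; reverse)
  open import Data.Product using (_×_; _,_)
  open import Data.Unit using (tt)
  open import Function using (_∘_)
  open import Relation.Binary.PropositionalEquality using (_≡_; refl)

  data Letter : Set where
    a b c : Letter

  pattern O = false
  pattern I = true

  -- Simpson's modified Padovan words are p₁ = b and p₍ₙ₊₅₎ = reverse (f pₙ);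
  -- word is h p₃₁.
  f : Letter → List Letter
  f a = a ∷ a ∷ c ∷ a ∷ b ∷ []
  f b = a ∷ c ∷ a ∷ b ∷ []
  f c = a ∷ c ∷ []

  h : Letter → List Bool
  h a = I ∷ O ∷ I ∷ O ∷ O ∷ I ∷ O ∷ I ∷ I ∷ O ∷ O ∷ I ∷
        O ∷ I ∷ O ∷ O ∷ I ∷ O ∷ I ∷ I ∷ O ∷ I ∷ O ∷ O ∷ []
  h b = I ∷ O ∷ I ∷ O ∷ O ∷ I ∷ O ∷ I ∷ I ∷ O ∷ I ∷ O ∷ O ∷ []
  h c = I ∷ O ∷ I ∷ O ∷ O ∷ I ∷ O ∷ I ∷ []

  g : List Letter → List Letter
  g = reverse ∘ concatMap f

  word : List Bool
  word = concatMap h (g (g (g (g (g (g (b ∷ [])))))))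

  -- The periods from 56 on obey the Padovan recurrence: each is the sum of those two and three rows
  -- earlier, starting from 24, 32, 37. The next two terms are 60064, the denominator of the bound,
  -- and 79568, the length of `word`. Periods 5 and 13 occur twice because the windows of 6 and 19
  -- lie between theirs. Any table yields a valid lower bound; the windows decide how many runs it
  -- captures.
  rows : List (ℕ × ℕ)
  rows =
    (1 , 2) ∷ (2 , 3) ∷ (3 , 1) ∷ (5 , 5) ∷ (6 , 1) ∷ (5 , 1) ∷ (8 , 5) ∷ (11 , 6) ∷ (13 , 8) ∷
    (19 , 6) ∷ (13 , 1) ∷ (24 , 19) ∷ (32 , 14) ∷ (37 , 21) ∷ (56 , 45) ∷ (69 , 34) ∷ (93 , 54) ∷
    (125 , 80) ∷ (162 , 100) ∷ (218 , 133) ∷ (287 , 168) ∷ (380 , 234) ∷ (505 , 313) ∷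
    (667 , 401) ∷ (885 , 535) ∷ (1172 , 715) ∷ (1552 , 948) ∷ (2057 , 1249) ∷ (2724 , 1651) ∷
    (3609 , 2198) ∷ (4781 , 2912) ∷ (6333 , 3848) ∷ (8390 , 5098) ∷ (11114 , 6761) ∷
    (14723 , 8958) ∷ (19504 , 11858) ∷ (25837 , 6333) ∷ (34227 , 30191) ∷ (45341 , 11114) ∷ []

  length-word : length word ≡ 79568
  length-word = refl

  -- Holds by evaluation of 39 scans, one per row.
  count-word : count (length word) (word ++ word ++ word) 0 rows ≡ 75156
  count-word = refl

  dense : 79568 * 56733 ≤ 75156 * 60064
  dense = ≤ᵇ⇒≤ (79568 * 56733) (75156 * 60064) tt

  56733<60064 : 56733 < 60064
  56733<60064 = <ᵇ⇒< 56733 60064 tt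

open import Data.Nat using (ℕ; _≤_)
open import Data.Fin using (Fin)
open import Data.Vec using (Vec)
open import Data.Product using (Σ; _×_; ∃-syntax)
open import Data.Integer using (+_)
open import Data.Rational using (ℚ; _/_; _-_; _*_; _<_; 0ℚ)

theorem3 : (ε : ℚ) → 0ℚ < ε →
    ∃[ N ] (1 ≤ N × ((n : ℕ) → N ≤ n →
    ∃[ k ] Σ (Vec (Fin k) n) λ w →
    ((+ 56733 / 60064) - ε) * (+ n / 1) < (+ run w / 1)))
theorem3 = Density.run-density 56733 60064 word rows 56733<60064 length-word count-word dense
  where open PadovanWord
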